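{- Let $m$ be a positive integer and let $G$ be an $m$-sparse graph with $|E(G)|=m(|V(G)|-1)$. Then for every partition $P$ of $V(G)$, $e_G(P)\ge m(|P|-1)+p_0$, where $p_0$ is the number of sets $X\in P$ such that $G[X]$ is not $m$-tree-connected.
   Context: Graphs are finite, loopless, and may have multiple edges. A graph $F$ is $m$-sparse if $e_F(S)\le m|S|-m$ for every nonempty $S\subseteq V(F)$, where $e_F(S)$ is the number of edges of $F$ with both ends in $S$. A graph is $m$-tree-connected if it contains $m$ pairwise edge-disjoint spanning trees (a one-vertex graph is $m$-tree-connected). For a partition $P$ of $V(G)$, $e_G(P)$ is the number of edges of $G$ whose ends lie in different parts of $P$. $G[X]$ is the induced subgraph on $X$. -}

module Defs where

open import Data.Nat using (ℕ; zero; suc; _+_; _*_; _∸_; _≤_)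
open import Data.Bool using (Bool; true; false; if_then_else_; _∧_; not)
open import Relation.Nullary.Decidable using (does)
open import Data.Fin using (Fin; zero; suc; _≟_)
open import Data.Fin.Subset using (Subset; _∈_; Nonempty; ∣_∣)
open import Data.Vec using (lookup)
open import Data.Product using (_×_; _,_; proj₁; proj₂; Σ; ∃)
open import Data.Sum using (_⊎_)
open import Data.Empty using (⊥)
open import Relation.Nullary using (¬_)
open import Relation.Binary.PropositionalEquality using (_≡_; _≢_)
open import Function.Bundles using (_⇔_)
open import Function.Definitions using (Surjective)

-- A finite loopless multigraph on vertex set Fin n with k edges;
-- edge e has ends (ends e); parallel edges are allowed.
record Graph : Set where
  field
    n        : ℕ
    k        : ℕ
    ends     : Fin k → Fin n × Fin n
    loopless : ∀ e → proj₁ (ends e) ≢ proj₂ (ends e)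
open Graph public

count : ∀ {j} → (Fin j → Bool) → ℕ
count {zero}  f = 0
count {suc j} f = (if f zero then 1 else 0) + count (λ i → f (suc i))

eInside : (G : Graph) → Subset (n G) → ℕ
eInside G S = count (λ e → lookup S (proj₁ (ends G e)) ∧ lookup S (proj₂ (ends G e)))

Sparse : ℕ → Graph → Set
Sparse m G = ∀ (S : Subset (n G)) → Nonempty S → eInside G S ≤ m * ∣ S ∣ ∸ m

VSet : Graph → Set₁
VSet G = Fin (n G) → Set

ESet : Graph → Set₁
ESet G = Fin (k G) → Set

Joins : (G : Graph) → Fin (k G) → Fin (n G) → Fin (n G) → Set
Joins G e u w = (ends G e ≡ (u , w)) ⊎ (ends G e ≡ (w , u))

data Reach (G : Graph) (T : ESet G) : Fin (n G) → Fin (n G) → Set where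
  here : ∀ {u} → Reach G T u u
  step : ∀ {u w v} (e : Fin (k G)) → T e → Joins G e u w → Reach G T w v → Reach G T u v

without : (G : Graph) → ESet G → Fin (k G) → ESet G
without G T e f = T f × f ≢ e

-- T is a spanning tree of G[X]: every edge of T lies in G[X], T connects all
-- vertices of X, and T is acyclic (no edge of T has its ends joined in T - e).
SpanningTree : (G : Graph) → VSet G → ESet G → Set
SpanningTree G X T =
  (∀ e → T e → X (proj₁ (ends G e)) × X (proj₂ (ends G e)))
  × (∀ u v → X u → X v → Reach G T u v)
  × (∀ e → T e → ¬ Reach G (without G T e) (proj₁ (ends G e)) (proj₂ (ends G e)))

TreeConnected : ℕ → (G : Graph) → VSet G → Set₁
TreeConnected m G X =
  Σ (Fin m → ESet G) λ T →
    (∀ i → SpanningTree G X (T i))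
    × (∀ i j e → i ≢ j → T i e → T j e → ⊥)

record Partition (G : Graph) (p : ℕ) : Set where
  field
    part : Fin (n G) → Fin p
    onto : Surjective _≡_ _≡_ part
open Partition public

Part : {G : Graph} {p : ℕ} → Partition G p → Fin p → VSet G
Part P i v = part P v ≡ i

eCross : (G : Graph) {p : ℕ} → Partition G p → ℕ
eCross G P = count λ e → not (does (part P (proj₁ (ends G e)) ≟ part P (proj₂ (ends G e))))

{-# OPTIONS --safe #-}
module Submission where

-- Call a part X tight if G[X] has m|X| - m edges.  Sparsity bounds the edges
-- inside a part by m|X| - m, and by one less if the part is not tight, so the
-- inequality follows by summing over the parts once tight parts are known to be
-- m-tree-connected.  For this it suffices that the edges of G decompose into m
-- forests: each has at most |X| - 1 edges in a tight part X, hence exactly that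
-- many, and so induces a spanning tree of G[X].
--
-- The decomposition is the Nash-Williams theorem.  Take m disjoint forests
-- covering as many edges as possible and an uncovered edge e₀, and let C be the
-- set of edges that become uncovered after successive exchanges.  The ends of an
-- edge of C are joined in each forest by edges of C, so the component U of C
-- containing e₀ is connected in each forest; with e₀ itself this makes more than
-- m|U| - m edges inside U.  As "not m-tree-connected" is a negation, all of this
-- is only needed up to double negation.

open import Defs
open import Data.Nat using (ℕ; zero; suc; _+_; _*_; _∸_; _≤_; _<_; NonZero; z≤n; s≤s)
open import Data.Nat.Properties hiding (_≟_)
open import Data.Nat.Tactic.RingSolver using (solve-∀)
open import Data.Bool using (Bool; true; false; if_then_else_; _∧_; not)
import Data.Bool.Properties as Bool
open import Data.Fin using (Fin; zero; suc; _≟_)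
import Data.Fin.Properties as Fin
open import Data.Fin.Subset using (∣_∣)
open import Data.Vec using (tabulate)
open import Data.Vec.Properties using (lookup∘tabulate; lookup⇒[]=)
open import Data.Maybe using (Maybe; just; nothing)
open import Data.Product using (_×_; _,_; proj₁; proj₂; Σ; ∃)
open import Data.Sum using (_⊎_; inj₁; inj₂)
open import Data.Empty using (⊥; ⊥-elim)
open import Relation.Nullary using (¬_; Dec; yes; no; contradiction)
open import Relation.Nullary.Decidable using (does; dec-true; dec-false; map′; _×-dec_; ¬¬-excluded-middle)
open import Relation.Binary.PropositionalEquality
open import Function.Base using (_∘_)
open import Function.Bundles using (_⇔_; Equivalence)

-- Booleans, double negation and counting.

∧-fst : ∀ {a b} → a ∧ b ≡ true → a ≡ true
∧-fst {true} _ = refl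

∧-snd : ∀ {a b} → a ∧ b ≡ true → b ≡ true
∧-snd {true} p = p

∧-intro : ∀ {a b} → a ≡ true → b ≡ true → a ∧ b ≡ true
∧-intro refl refl = refl

does-true⇒ : ∀ {A : Set} (d : Dec A) → does d ≡ true → A
does-true⇒ (yes a) _ = a

-- Finitely many instances of excluded middle can be assumed together when the goal is a negation.
-- This later allows `C` to be treated as decidable.
¬¬-dec : ∀ {j} (P : Fin j → Set) → ¬ ¬ (∀ i → Dec (P i))
¬¬-dec {zero}  P κ = κ λ ()
¬¬-dec {suc j} P κ =
  ¬¬-excluded-middle λ d → ¬¬-dec (P ∘ suc) λ ds → κ λ { zero → d ; (suc i) → ds i }

bit : Bool → ℕ
bit b = if b then 1 else 0

count-cong : ∀ {j} {s t : Fin j → Bool} → (∀ i → s i ≡ t i) → count s ≡ count t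
count-cong {zero}  eq = refl
count-cong {suc j} eq = cong₂ _+_ (cong bit (eq zero)) (count-cong (eq ∘ suc))

count-false : ∀ {j} {t : Fin j → Bool} → (∀ i → t i ≡ false) → count t ≡ 0
count-false {zero}  h = refl
count-false {suc j} h = cong₂ _+_ (cong bit (h zero)) (count-false (h ∘ suc))

count-true : ∀ j → count {j} (λ _ → true) ≡ j
count-true zero    = refl
count-true (suc j) = cong suc (count-true j)

remove : ∀ {j} → Fin j → (Fin j → Bool) → Fin j → Bool
remove e t f = t f ∧ not (does (f ≟ e))

remove-⊆ : ∀ {j} {e : Fin j} {t f} → remove e t f ≡ true → t f ≡ true
remove-⊆ = ∧-fst

remove-≢ : ∀ {j} {e : Fin j} {t f} → remove e t f ≡ true → f ≢ e
remove-≢ {e = e} {t} {f} p f≡e with ∧-snd {t f} p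
... | q rewrite dec-true (f ≟ e) f≡e = contradiction q λ ()

remove-∋ : ∀ {j} {e : Fin j} {t f} → t f ≡ true → f ≢ e → remove e t f ≡ true
remove-∋ {e = e} {t} {f} p f≢e = ∧-intro p (cong not (dec-false (f ≟ e) f≢e))

count-remove : ∀ {j} (e : Fin j) t → t e ≡ true → count t ≡ suc (count (remove e t))
count-remove {suc j} zero t p rewrite p =
  cong suc (count-cong λ i → sym (Bool.∧-identityʳ (t (suc i))))
count-remove {suc j} (suc e) t p =
  trans (cong₂ _+_ (cong bit (sym (Bool.∧-identityʳ (t zero)))) (count-remove e (t ∘ suc) p))
        (+-suc _ _)

count-witness : ∀ {j N} {t : Fin j → Bool} → count t ≡ suc N → ∃ λ e → t e ≡ true
count-witness {suc j} {t = t} p with t zero in eq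
... | true  = zero , eq
... | false with count-witness {t = t ∘ suc} p
...   | e , q = suc e , q

count≡0⇒ : ∀ {j} {t : Fin j → Bool} {e} → count t ≡ 0 → t e ≡ true → ⊥
count≡0⇒ {t = t} {e} p q with trans (sym (count-remove e t q)) p
... | ()

count≡1⇒≡ : ∀ {j} {t : Fin j → Bool} {a b} → count t ≡ 1 → t a ≡ true → t b ≡ true → a ≡ b
count≡1⇒≡ {t = t} {a} {b} one ta tb with b ≟ a
... | yes b≡a = sym b≡a
... | no  b≢a = ⊥-elim (count≡0⇒ {t = remove a t} {b}
                  (suc-injective (trans (sym (count-remove a t ta)) one))
                  (remove-∋ {e = a} {t} tb b≢a))

unique⇒count≤1 : ∀ {j} {t : Fin j → Bool} → (∀ a b → t a ≡ true → t b ≡ true → a ≡ b) → count t ≤ 1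
unique⇒count≤1 {t = t} uniq with count t in eq
... | 0 = z≤n
... | 1 = ≤-refl
... | suc (suc N) with count-witness {t = t} eq
...   | a , ta with count-witness {t = remove a t} (suc-injective (trans (sym (count-remove a t ta)) eq))
...     | b , rb = ⊥-elim (remove-≢ {e = a} {t} rb (uniq b a (remove-⊆ {e = a} {t} rb) ta))

∣tabulate∣ : ∀ {j} (t : Fin j → Bool) → ∣ tabulate t ∣ ≡ count t
∣tabulate∣ {zero}  t = refl
∣tabulate∣ {suc j} t with t zero
... | true  = cong suc (∣tabulate∣ (t ∘ suc))
... | false = ∣tabulate∣ (t ∘ suc)

-- Finite sums.

sumF : ∀ {j} → (Fin j → ℕ) → ℕ
sumF {zero}  f = 0
sumF {suc j} f = f zero + sumF (f ∘ suc)

sumF-cong : ∀ {j} {f g : Fin j → ℕ} → (∀ i → f i ≡ g i) → sumF f ≡ sumF g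
sumF-cong {zero}  h = refl
sumF-cong {suc j} h = cong₂ _+_ (h zero) (sumF-cong (h ∘ suc))

sumF-mono : ∀ {j} {f g : Fin j → ℕ} → (∀ i → f i ≤ g i) → sumF f ≤ sumF g
sumF-mono {zero}  h = z≤n
sumF-mono {suc j} h = +-mono-≤ (h zero) (sumF-mono (h ∘ suc))

+-interchange : ∀ a b c d → (a + b) + (c + d) ≡ (a + c) + (b + d)
+-interchange = solve-∀

sumF-+ : ∀ {j} (f g : Fin j → ℕ) → sumF (λ i → f i + g i) ≡ sumF f + sumF g
sumF-+ {zero}  f g = refl
sumF-+ {suc j} f g rewrite sumF-+ (f ∘ suc) (g ∘ suc) = +-interchange (f zero) (g zero) _ _

sumF-const : ∀ j c → sumF {j} (λ _ → c) ≡ j * c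
sumF-const zero    c = refl
sumF-const (suc j) c = cong (c +_) (sumF-const j c)

sumF-* : ∀ {j} c (f : Fin j → ℕ) → sumF (λ i → c * f i) ≡ c * sumF f
sumF-* {zero}  c f = sym (*-zeroʳ c)
sumF-* {suc j} c f rewrite sumF-* c (f ∘ suc) = sym (*-distribˡ-+ c _ _)

sumF-bit : ∀ {j} (t : Fin j → Bool) → sumF (bit ∘ t) ≡ count t
sumF-bit {zero}  t = refl
sumF-bit {suc j} t = cong (bit (t zero) +_) (sumF-bit (t ∘ suc))

-- A deficit in one term cannot be made up by the others, as each is at most `a`.
sumF-tight : ∀ {j a} (f : Fin j → ℕ) → (∀ i → f i ≤ a) → sumF f ≡ j * a → ∀ i → f i ≡ a
sumF-tight {suc j} {a} f f≤a eq = λ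
  { zero    → head
  ; (suc i) → sumF-tight (f ∘ suc) (f≤a ∘ suc)
                (+-cancelˡ-≡ a _ _ (trans (cong (_+ sumF (f ∘ suc)) (sym head)) eq)) i }
  where
  rest≤ : sumF (f ∘ suc) ≤ j * a
  rest≤ = subst (sumF (f ∘ suc) ≤_) (sumF-const j a) (sumF-mono (f≤a ∘ suc))
  head : f zero ≡ a
  head = ≤-antisym (f≤a zero)
    (+-cancelʳ-≤ (j * a) _ _ (≤-trans (≤-reflexive (sym eq)) (+-monoʳ-≤ (f zero) rest≤)))

-- Partial maps to a finite set and their fibres.

is : ∀ {j} → Fin j → Maybe (Fin j) → Bool
is i nothing  = false
is i (just l) = does (i ≟ l)

isNothing : ∀ {A : Set} → Maybe A → Bool
isNothing nothing  = true
isNothing (just _) = false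

is-just : ∀ {j} {i : Fin j} {c} → is i c ≡ true → c ≡ just i
is-just {i = i} {just l} p = cong just (sym (does-true⇒ (i ≟ l) p))

is-injective : ∀ {j} {i l : Fin j} c → is i c ≡ true → is l c ≡ true → i ≡ l
is-injective {i = i} {l} (just a) p q = trans (does-true⇒ (i ≟ a) p) (sym (does-true⇒ (l ≟ a) q))

count-≟ : ∀ {j} (l : Fin j) → count (λ i → does (i ≟ l)) ≡ 1
count-≟ l = trans (count-remove l _ (dec-true (l ≟ l) refl))
                  (cong suc (count-false λ i → nope (does (i ≟ l))))
  where
  nope : ∀ b → b ∧ not b ≡ false
  nope true  = refl
  nope false = refl

-- Each element lies in exactly one fibre of `c`, the fibre over `nothing` included. It serves to
-- split edges by colour, vertices by part, and edges into those inside parts and those crossing.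
count-fibres : ∀ {j k} (b : Fin k → Bool) (c : Fin k → Maybe (Fin j)) →
  sumF (λ i → count λ e → b e ∧ is i (c e)) + count (λ e → b e ∧ isNothing (c e)) ≡ count b
count-fibres {j} {zero}  b c =
  trans (+-identityʳ _) (trans (sumF-const j 0) (*-zeroʳ j))
count-fibres {j} {suc k} b c =
  begin
    sumF (λ i → head i + tail i) + (bit (b zero ∧ isNothing (c zero)) + rest)
  ≡⟨ cong (_+ (bit (b zero ∧ isNothing (c zero)) + rest)) (sumF-+ head tail) ⟩
    sumF head + sumF tail + (bit (b zero ∧ isNothing (c zero)) + rest)
  ≡⟨ +-interchange (sumF head) (sumF tail) _ rest ⟩
    sumF head + bit (b zero ∧ isNothing (c zero)) + (sumF tail + rest)
  ≡⟨ cong₂ _+_ (single (b zero) (c zero)) (count-fibres (b ∘ suc) (c ∘ suc)) ⟩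
    count b
  ∎
  where
  open ≡-Reasoning
  head tail : Fin j → ℕ
  head i = bit (b zero ∧ is i (c zero))
  tail i = count λ e → b (suc e) ∧ is i (c (suc e))
  rest : ℕ
  rest = count λ e → b (suc e) ∧ isNothing (c (suc e))
  single : ∀ x y → sumF (λ i → bit (x ∧ is {j} i y)) + bit (x ∧ isNothing y) ≡ bit x
  single false y        = trans (+-identityʳ _) (trans (sumF-const j 0) (*-zeroʳ j))
  single true  nothing  = cong (_+ 1) (trans (sumF-const j 0) (*-zeroʳ j))
  single true  (just l) = trans (+-identityʳ _) (trans (sumF-bit (λ i → does (i ≟ l))) (count-≟ l))

_[_≔_] : ∀ {j} {A : Set} → (Fin j → A) → Fin j → A → Fin j → A
(f [ e ≔ a ]) g = if does (g ≟ e) then a else f g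

≔-eq : ∀ {j} {A : Set} {f : Fin j → A} {e a} → (f [ e ≔ a ]) e ≡ a
≔-eq {e = e} rewrite dec-true (e ≟ e) refl = refl

≔-neq : ∀ {j} {A : Set} {f : Fin j → A} {e a g} → g ≢ e → (f [ e ≔ a ]) g ≡ f g
≔-neq {e = e} {g = g} g≢e rewrite dec-false (g ≟ e) g≢e = refl

-- Walks and acyclic edge sets.

module _ (G : Graph) where

  V E : Set
  V = Fin (n G)
  E = Fin (k G)

  src tgt : E → V
  src e = proj₁ (ends G e)
  tgt e = proj₂ (ends G e)

  ⟦_⟧ : (E → Bool) → ESet G
  ⟦ t ⟧ e = t e ≡ true

  inside : (V → Bool) → E → Bool
  inside x e = x (src e) ∧ x (tgt e)

  _⊕_ : ESet G → E → ESet G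
  (S ⊕ e) f = S f ⊎ f ≡ e

  Acyclic : ESet G → Set
  Acyclic S = ∀ e → S e → ¬ Reach G (without G S e) (src e) (tgt e)

  Reach-mono : ∀ {S T : ESet G} {u v} → (∀ e → S e → T e) → Reach G S u v → Reach G T u v
  Reach-mono S⊆T here           = here
  Reach-mono S⊆T (step e s j p) = step e (S⊆T e s) j (Reach-mono S⊆T p)

  Reach-trans : ∀ {S : ESet G} {u v w} → Reach G S u v → Reach G S v w → Reach G S u w
  Reach-trans here           q = q
  Reach-trans (step e s j p) q = step e s j (Reach-trans p q)

  Reach-edge : ∀ {S : ESet G} {e} → S e → Reach G S (src e) (tgt e)
  Reach-edge {e = e} s = step e s (inj₁ refl) here

  Reach-edge⁻¹ : ∀ {S : ESet G} {e} → S e → Reach G S (tgt e) (src e)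
  Reach-edge⁻¹ {e = e} s = step e s (inj₂ refl) here

  Reach-sym : ∀ {S : ESet G} {u v} → Reach G S u v → Reach G S v u
  Reach-sym here                     = here
  Reach-sym (step e s (inj₁ refl) p) = Reach-trans (Reach-sym p) (Reach-edge⁻¹ s)
  Reach-sym (step e s (inj₂ refl) p) = Reach-trans (Reach-sym p) (Reach-edge s)

  Reach-bind : ∀ {S T : ESet G} {u v} → (∀ e → S e → Reach G T (src e) (tgt e)) →
    Reach G S u v → Reach G T u v
  Reach-bind h here                     = here
  Reach-bind h (step e s (inj₁ refl) p) = Reach-trans (h e s) (Reach-bind h p)
  Reach-bind h (step e s (inj₂ refl) p) = Reach-trans (Reach-sym (h e s)) (Reach-bind h p)

  Reach-closed : ∀ {S : ESet G} {X : VSet G} → (∀ e → S e → X (src e) × X (tgt e)) →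
    ∀ {u v} → X u → Reach G S u v → X v
  Reach-closed h xu here                     = xu
  Reach-closed h xu (step e s (inj₁ refl) p) = Reach-closed h (proj₂ (h e s)) p
  Reach-closed h xu (step e s (inj₂ refl) p) = Reach-closed h (proj₁ (h e s)) p

  -- Keep what precedes the first and what follows the last passage through `e`. If these pieces
  -- meet at the same end of `e`, then `e` drops out; otherwise it is crossed once.
  Reach-⊕ : ∀ {S : ESet G} {e u v} → Reach G (S ⊕ e) u v →
    Reach G S u v
    ⊎ (Reach G S u (src e) × Reach G S (tgt e) v)
    ⊎ (Reach G S u (tgt e) × Reach G S (src e) v)
  Reach-⊕ here = inj₁ here
  Reach-⊕ (step f (inj₁ s) j p) with Reach-⊕ p
  ... | inj₁ q               = inj₁ (step f s j q)
  ... | inj₂ (inj₁ (q , r))  = inj₂ (inj₁ (step f s j q , r))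
  ... | inj₂ (inj₂ (q , r))  = inj₂ (inj₂ (step f s j q , r))
  Reach-⊕ (step f (inj₂ refl) (inj₁ refl) p) with Reach-⊕ p
  ... | inj₁ q               = inj₂ (inj₁ (here , q))
  ... | inj₂ (inj₁ (q , r))  = inj₂ (inj₁ (here , r))
  ... | inj₂ (inj₂ (q , r))  = inj₁ r
  Reach-⊕ (step f (inj₂ refl) (inj₂ refl) p) with Reach-⊕ p
  ... | inj₁ q               = inj₂ (inj₂ (here , q))
  ... | inj₂ (inj₁ (q , r))  = inj₁ r
  ... | inj₂ (inj₂ (q , r))  = inj₂ (inj₂ (here , r))

  Acyclic-⊆ : ∀ {S T : ESet G} → (∀ e → S e → T e) → Acyclic T → Acyclic S
  Acyclic-⊆ S⊆T acyc e s p = acyc e (S⊆T e s) (Reach-mono (λ { f (sf , f≢e) → S⊆T f sf , f≢e }) p)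

  -- A cycle through `f` that avoids `e` is a cycle of `S`. One that uses `e` yields, on removing
  -- `e`, a walk in `S` between the ends of `e`.
  Acyclic-⊕ : ∀ {S : ESet G} {e} → Acyclic S → ¬ Reach G S (src e) (tgt e) → Acyclic (S ⊕ e)
  Acyclic-⊕ {S} {e} acyc ¬p f (inj₂ refl) q =
    ¬p (Reach-mono (λ { g (inj₁ s , _) → s ; g (inj₂ g≡e , g≢e) → contradiction g≡e g≢e }) q)
  Acyclic-⊕ {S} {e} acyc ¬p f (inj₁ sf) q
    with Reach-⊕ {S = without G S f} {e}
           (Reach-mono (λ { g (inj₁ s , g≢f) → inj₁ (s , g≢f) ; g (inj₂ g≡e , _) → inj₂ g≡e }) q)
  ... | inj₁ r = acyc f sf r
  ... | inj₂ (inj₁ (r , s)) = ¬p (Reach-trans (Reach-sym (Reach-mono (λ _ → proj₁) r))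
          (Reach-trans (Reach-edge sf) (Reach-sym (Reach-mono (λ _ → proj₁) s))))
  ... | inj₂ (inj₂ (r , s)) = ¬p (Reach-trans (Reach-mono (λ _ → proj₁) s)
          (Reach-trans (Reach-edge⁻¹ sf) (Reach-mono (λ _ → proj₁) r)))

  module _ {t : E → Bool} {e : E} where

    remove⊆without : ∀ f → ⟦ remove e t ⟧ f → without G ⟦ t ⟧ e f
    remove⊆without f r = remove-⊆ {e = e} {t} r , remove-≢ {e = e} {t} r

    ⊆remove⊕ : ∀ f → ⟦ t ⟧ f → (⟦ remove e t ⟧ ⊕ e) f
    ⊆remove⊕ f s = split (f ≟ e)
      where
      split : Dec (f ≡ e) → (⟦ remove e t ⟧ ⊕ e) f
      split (yes f≡e) = inj₂ f≡e
      split (no  f≢e) = inj₁ (remove-∋ {e = e} {t} s f≢e)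

  -- Components, rank and decidable reachability.

  EdgesIn : (V → Bool) → (E → Bool) → Set
  EdgesIn x t = ∀ e → t e ≡ true → x (src e) ≡ true × x (tgt e) ≡ true

  -- L picks a representative in every component of (V , t).
  record Labelling (x : V → Bool) (t : E → Bool) : Set where
    field
      L        : V → V
      idem     : ∀ v → L (L v) ≡ L v
      complete : ∀ {u v} → Reach G ⟦ t ⟧ u v → L u ≡ L v
      sound    : ∀ {u v} → L u ≡ L v → Reach G ⟦ t ⟧ u v

    root : V → Bool
    root v = x v ∧ does (L v ≟ v)

    field
      -- Starting from one root per vertex, an added edge destroys at most one root, and exactly one
      -- if it closes no cycle.
      rank≤  : count x ≤ count root + count t
      forest : Acyclic ⟦ t ⟧ → count root + count t ≡ count x

    -- The walk from `v` to its label uses only edges with both ends in `x`, so the label lies in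
    -- `x` too.
    L-root : EdgesIn x t → ∀ v → x v ≡ true → root (L v) ≡ true
    L-root h v xv = ∧-intro
      (Reach-closed {X = λ w → x w ≡ true} h xv (sound (sym (idem v))))
      (dec-true (L (L v) ≟ L v) (idem v))

  -- If the ends of `e` have the same label, the components do not change and `e` closes a cycle, so
  -- `forest` holds vacuously. Otherwise the component of `src e` takes over the label of `tgt e`,
  -- and one root is lost.
  addEdge : ∀ {x t e} → EdgesIn x t → t e ≡ true → Labelling x (remove e t) → Labelling x t
  addEdge {x} {t} {e} t⊆x te ℓ with Labelling.L ℓ (src e) ≟ Labelling.L ℓ (tgt e)
  ... | yes same = record
    { L        = L
    ; idem     = idem
    ; complete = λ p → complete (Reach-bind old p)
    ; sound    = λ eq → Reach-mono (λ f → remove-⊆ {e = e} {t}) (sound eq)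
    ; rank≤    = ≤-trans rank≤ (+-monoʳ-≤ (count root)
                   (≤-trans (n≤1+n _) (≤-reflexive (sym (count-remove e t te)))))
    ; forest   = λ acyc → contradiction (Reach-mono remove⊆without (sound same)) (acyc e te)
    }
    where
    open Labelling ℓ
    old : ∀ f → ⟦ t ⟧ f → Reach G ⟦ remove e t ⟧ (src f) (tgt f)
    old f s with ⊆remove⊕ {t} {e} f s
    ... | inj₁ r    = Reach-edge r
    ... | inj₂ refl = sound same
  ... | no differ = record
    { L        = L′
    ; idem     = idem′
    ; complete = complete′
    ; sound    = sound′
    ; rank≤    = ≤-trans rank≤ (≤-reflexive counts)
    ; forest   = λ acyc → trans (sym counts) (forest (Acyclic-⊆ (λ f → remove-⊆ {e = e} {t}) acyc))
    }
    where
    open Labelling ℓ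
    a b : V
    a = L (src e)
    b = L (tgt e)
    L′ : V → V
    L′ v = if does (L v ≟ a) then b else L v
    L′-hit : ∀ {v} → L v ≡ a → L′ v ≡ b
    L′-hit {v} eq rewrite dec-true (L v ≟ a) eq = refl
    L′-miss : ∀ {v} → L v ≢ a → L′ v ≡ L v
    L′-miss {v} neq rewrite dec-false (L v ≟ a) neq = refl
    Lb≢a : L b ≢ a
    Lb≢a eq = differ (sym (trans (sym (idem (tgt e))) eq))
    L′-cong : ∀ {u v} → L u ≡ L v → L′ u ≡ L′ v
    L′-cong eq = cong (λ w → if does (w ≟ a) then b else w) eq
    L′b : L′ b ≡ b
    L′b = trans (L′-miss Lb≢a) (idem (tgt e))
    idem′ : ∀ v → L′ (L′ v) ≡ L′ v
    idem′ v with L v ≟ a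
    ... | yes eq  = L′b
    ... | no  neq = trans (L′-cong (idem v)) (L′-miss neq)
    complete′ : ∀ {u v} → Reach G ⟦ t ⟧ u v → L′ u ≡ L′ v
    complete′ p with Reach-⊕ (Reach-mono (⊆remove⊕ {t} {e}) p)
    ... | inj₁ q              = L′-cong (complete q)
    ... | inj₂ (inj₁ (q , r)) = trans (L′-hit (complete q))
            (trans (sym (trans (L′-cong (sym (idem (tgt e)))) L′b)) (L′-cong (complete r)))
    ... | inj₂ (inj₂ (q , r)) = trans (trans (L′-cong (complete q)) (trans (L′-cong (sym (idem (tgt e)))) L′b))
            (sym (L′-hit (sym (complete r))))
    lift : ∀ {u v} → L u ≡ L v → Reach G ⟦ t ⟧ u v
    lift eq = Reach-mono (λ f → remove-⊆ {e = e} {t}) (sound eq)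
    toL′ : ∀ v → Reach G ⟦ t ⟧ v (L′ v)
    toL′ v with L v ≟ a
    ... | yes eq  = Reach-trans (lift eq) (Reach-trans (Reach-edge te) (lift (sym (idem (tgt e)))))
    ... | no  neq = lift (sym (idem v))
    sound′ : ∀ {u v} → L′ u ≡ L′ v → Reach G ⟦ t ⟧ u v
    sound′ {u} {v} eq = Reach-trans (toL′ u) (subst (λ w → Reach G ⟦ t ⟧ w v) (sym eq) (Reach-sym (toL′ v)))
    root′ : V → Bool
    root′ v = x v ∧ does (L′ v ≟ v)
    -- Only `a` stops being a root: vertices labelled `a` now get `b`, which is not among them, and
    -- all other labels stay.
    root′≡ : ∀ v → remove a root v ≡ root′ v
    root′≡ v = trans (Bool.∧-assoc (x v) _ _) (cong (x v ∧_) (fix v))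
      where
      fix : ∀ v → does (L v ≟ v) ∧ not (does (v ≟ a)) ≡ does (L′ v ≟ v)
      fix v with L v ≟ a
      fix v | yes eq = trans (Bool.∧-comm (does (L v ≟ v)) _) (trans (side (v ≟ a)) (sym (dec-false (b ≟ v) b≢v)))
        where
        b≢v : b ≢ v
        b≢v refl = Lb≢a eq
        side : (d : Dec (v ≡ a)) → not (does d) ∧ does (L v ≟ v) ≡ false
        side (yes _)   = refl
        side (no v≢a) = dec-false (L v ≟ v) λ Lv≡v → v≢a (trans (sym Lv≡v) eq)
      fix v | no neq with v ≟ a
      ... | no  _   = Bool.∧-identityʳ _
      ... | yes v≡a = contradiction (trans (cong L v≡a) (idem (src e))) neq
    root-a : root a ≡ true
    root-a = L-root (λ f r → t⊆x f (remove-⊆ {e = e} {t} r)) (src e) (proj₁ (t⊆x e te))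
    counts : count root + count (remove e t) ≡ count root′ + count t
    counts = trans (cong (_+ count (remove e t))
                     (trans (count-remove a root root-a) (cong suc (count-cong root′≡))))
             (trans (sym (+-suc _ _)) (cong (count root′ +_) (sym (count-remove e t te))))

  labelling : ∀ {x t} → EdgesIn x t → Labelling x t
  labelling {x} {t} t⊆x = go (count t) t refl t⊆x
    where
    go : ∀ N t → count t ≡ N → EdgesIn x t → Labelling x t
    go zero t none t⊆x = record
      { L        = λ v → v
      ; idem     = λ _ → refl
      ; complete = λ { here → refl ; (step e s _ _) → ⊥-elim (count≡0⇒ {t = t} none s) }
      ; sound    = λ { refl → here }
      ; rank≤    = ≤-reflexive (sym all-roots)
      ; forest   = λ _ → all-roots
      }
      where
      all-roots : count (λ v → x v ∧ does (v ≟ v)) + count t ≡ count x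
      all-roots = trans (cong₂ _+_
        (count-cong λ v → trans (cong (x v ∧_) (dec-true (v ≟ v) refl)) (Bool.∧-identityʳ _)) none)
        (+-identityʳ _)
    go (suc N) t some t⊆x with count-witness {t = t} some
    ... | e , te = addEdge t⊆x te (go N (remove e t) (suc-injective (trans (sym (count-remove e t te)) some))
                     (λ f r → t⊆x f (remove-⊆ {e = e} {t} r)))

  -- Comparing labels replaces a search over walks. Taking all vertices as `x` makes the condition
  -- on edges trivial.
  Reach? : ∀ t u v → Dec (Reach G ⟦ t ⟧ u v)
  Reach? t u v = map′ sound complete (L u ≟ L v)
    where open Labelling (labelling {λ _ → true} {t} (λ _ _ → refl , refl))

  -- Connectedness leaves at most one root in `x`, and `rank≤` does the rest.
  connected⇒count : ∀ {x t} → EdgesIn x t →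
    (∀ u v → x u ≡ true → x v ≡ true → Reach G ⟦ t ⟧ u v) → count x ≤ suc (count t)
  connected⇒count {x} {t} t⊆x conn = ≤-trans rank≤ (+-monoˡ-≤ (count t) (unique⇒count≤1 uniq))
    where
    open Labelling (labelling {x} {t} t⊆x)
    fixed : ∀ v → root v ≡ true → L v ≡ v
    fixed v r = does-true⇒ (L v ≟ v) (∧-snd {x v} r)
    uniq : ∀ u v → root u ≡ true → root v ≡ true → u ≡ v
    uniq u v ru rv = trans (sym (fixed u ru)) (trans (complete (conn u v (∧-fst ru) (∧-fst rv))) (fixed v rv))

  -- The label of `v` is a root in `x`, so the exact count for forests has at least one root.
  forest⇒count : ∀ {x t v} → EdgesIn x t → x v ≡ true → Acyclic ⟦ t ⟧ → suc (count t) ≤ count x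
  forest⇒count {x} {t} {v} t⊆x xv acyc =
    ≤-trans (+-monoˡ-≤ (count t) (≤-trans (s≤s z≤n) (≤-reflexive (sym (count-remove (L v) root (L-root t⊆x v xv))))))
      (≤-reflexive (forest acyc))
    where open Labelling (labelling {x} {t} t⊆x)

  -- With this many edges the exact count leaves a single root, so all labels in `x` coincide.
  forest⇒connected : ∀ {x t} → EdgesIn x t → Acyclic ⟦ t ⟧ → suc (count t) ≡ count x →
    ∀ u v → x u ≡ true → x v ≡ true → Reach G ⟦ t ⟧ u v
  forest⇒connected {x} {t} t⊆x acyc full u v xu xv =
    sound (count≡1⇒≡ (+-cancelʳ-≡ (count t) _ 1 (trans (forest acyc) (sym full)))
            (L-root t⊆x u xu) (L-root t⊆x v xv))
    where open Labelling (labelling {x} {t} t⊆x)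

  -- Paths in forests.

  -- In a forest joining `u` to `v` these are the edges of the path between them, that is, the edges
  -- that can be exchanged for a new edge from `u` to `v`.
  Essential : ESet G → V → V → ESet G
  Essential S u v f = S f × ¬ Reach G (without G S f) u v

  -- Delete edges as long as `u` and `v` stay joined. An edge `f` of the minimal set `s` that
  -- results is essential even in `t`: a walk from `u` to `v` in `t` without `f`, together with the
  -- rest of `s`, would join the ends of `f` and close a cycle.
  essential-path : ∀ {t u v} → Acyclic ⟦ t ⟧ → Reach G ⟦ t ⟧ u v → Reach G (Essential ⟦ t ⟧ u v) u v
  essential-path {t} {u} {v} acyc p = go (count t) t refl (λ _ s → s) p
    where
    go : ∀ N s → count s ≡ N → (∀ f → ⟦ s ⟧ f → ⟦ t ⟧ f) → Reach G ⟦ s ⟧ u v →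
      Reach G (Essential ⟦ t ⟧ u v) u v
    go zero s none s⊆t here = here
    go zero s none s⊆t (step e se _ _) = ⊥-elim (count≡0⇒ {t = s} none se)
    go (suc N) s some s⊆t q
      with Fin.any? (λ f → (s f Bool.≟ true) ×-dec (Reach? (remove f s) u v))
    ... | yes (f , sf , r) = go N (remove f s) (suc-injective (trans (sym (count-remove f s sf)) some))
            (λ g g∈ → s⊆t g (remove-⊆ {e = f} {s} g∈)) r
    ... | no minimal = Reach-mono (λ f sf → s⊆t f sf , essential f sf) q
      where
      up : ∀ {f a b} → Reach G ⟦ remove f s ⟧ a b → Reach G (without G ⟦ t ⟧ f) a b
      up {f} = Reach-mono λ g g∈ → s⊆t g (remove-⊆ {e = f} {s} g∈) , remove-≢ {e = f} {s} g∈
      essential : ∀ f → ⟦ s ⟧ f → ¬ Reach G (without G ⟦ t ⟧ f) u v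
      essential f sf r with Reach-⊕ (Reach-mono (⊆remove⊕ {s} {f}) q)
      ... | inj₁ q′ = minimal (f , sf , q′)
      ... | inj₂ (inj₁ (q₁ , q₂)) = acyc f (s⊆t f sf)
              (Reach-trans (Reach-sym (up q₁)) (Reach-trans r (Reach-sym (up q₂))))
      ... | inj₂ (inj₂ (q₁ , q₂)) = acyc f (s⊆t f sf)
              (Reach-trans (up q₂) (Reach-trans (Reach-sym r) (up q₁)))

  -- Sparsity for Boolean masks and restriction to vertex sets.

  eInside-tabulate : ∀ x → eInside G (tabulate x) ≡ count (inside x)
  eInside-tabulate x = count-cong λ e → cong₂ _∧_ (lookup∘tabulate x (src e)) (lookup∘tabulate x (tgt e))

  sparse-mask : ∀ {m x v} → Sparse m G → x v ≡ true → count (inside x) ≤ m * count x ∸ m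
  sparse-mask {m} {x} {v} sparse xv =
    subst₂ (λ p q → p ≤ m * q ∸ m) (eInside-tabulate x) (∣tabulate∣ x)
      (sparse (tabulate x) (v , lookup⇒[]= v (tabulate x) (trans (lookup∘tabulate x v) xv)))

  -- A walk in `S` starting in `X` never leaves it, since no edge of `S` has just one end in `X`.
  Reach-restrict : ∀ {S T : ESet G} {X : VSet G} →
    (∀ e → S e → X (src e) ⊎ X (tgt e) → X (src e) × X (tgt e)) →
    (∀ e → S e → X (src e) → X (tgt e) → T e) →
    ∀ {u v} → X u → Reach G S u v → Reach G T u v
  Reach-restrict closed S⊆T xu here = here
  Reach-restrict {X = X} closed S⊆T xu (step e s (inj₁ refl) p) with closed e s (inj₁ xu)
  ... | xs , xt = step e (S⊆T e s xs xt) (inj₁ refl) (Reach-restrict {X = X} closed S⊆T xt p)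
  Reach-restrict {X = X} closed S⊆T xu (step e s (inj₂ refl) p) with closed e s (inj₂ xu)
  ... | xs , xt = step e (S⊆T e s xs xt) (inj₂ refl) (Reach-restrict {X = X} closed S⊆T xs p)

  inside-EdgesIn : ∀ x (t : E → Bool) → EdgesIn x (λ e → inside x e ∧ t e)
  inside-EdgesIn x t e p = ∧-fst ends∈x , ∧-snd {x (src e)} ends∈x
    where
    ends∈x : inside x e ≡ true
    ends∈x = ∧-fst p

  -- Partial decompositions into forests.

  module _ {m : ℕ} where

    -- Since an edge has at most one colour, disjointness of the forests is built in; `nothing`
    -- marks an uncovered edge.
    Colouring : Set
    Colouring = E → Maybe (Fin m)

    class : Colouring → Fin m → E → Bool
    class c i e = is i (c e)

    Forests : Colouring → Set
    Forests c = ∀ i → Acyclic ⟦ class c i ⟧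

    uncovered : Colouring → ℕ
    uncovered c = count (isNothing ∘ c)

    -- Only class `i` can grow, and it gains just `e`, whose ends it did not join.
    Forests-cover : ∀ {c e i} → Forests c → ¬ Reach G ⟦ class c i ⟧ (src e) (tgt e) →
      Forests (c [ e ≔ just i ])
    Forests-cover {c} {e} {i} forests ¬p j with j ≟ i
    ... | yes refl = Acyclic-⊆ old-or-e (Acyclic-⊕ (forests j) ¬p)
      where
      old-or-e : ∀ f → ⟦ class (c [ e ≔ just j ]) j ⟧ f → (⟦ class c j ⟧ ⊕ e) f
      old-or-e f q with f ≟ e
      ... | yes f≡e = inj₂ f≡e
      ... | no  _   = inj₁ q
    ... | no j≢i = Acyclic-⊆ old (forests j)
      where
      old : ∀ f → ⟦ class (c [ e ≔ just i ]) j ⟧ f → ⟦ class c j ⟧ f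
      old f q with f ≟ e
      ... | yes _ = contradiction (does-true⇒ (j ≟ i) q) j≢i
      ... | no  _ = q

    uncover⊆without : ∀ {c f i} g → ⟦ class (c [ f ≔ nothing ]) i ⟧ g → without G ⟦ class c i ⟧ f g
    uncover⊆without {f = f} g q with g ≟ f
    ... | no g≢f = q , g≢f

    Forests-uncover : ∀ {c f} → Forests c → Forests (c [ f ≔ nothing ])
    Forests-uncover {c} {f} forests i =
      Acyclic-⊆ (λ g q → proj₁ (uncover⊆without {c} {f} {i} g q)) (forests i)

    uncovered-cover : ∀ {c : Colouring} {e i} → c e ≡ nothing →
      suc (uncovered (c [ e ≔ just i ])) ≡ uncovered c
    uncovered-cover {c} {e} {i} ce =
      sym (trans (count-remove e (isNothing ∘ c) (cong isNothing ce)) (cong suc (count-cong same)))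
      where
      same : ∀ g → remove e (isNothing ∘ c) g ≡ isNothing ((c [ e ≔ just i ]) g)
      same g with g ≟ e
      ... | yes _ = Bool.∧-zeroʳ _
      ... | no  _ = Bool.∧-identityʳ _

    uncovered-uncover : ∀ {c : Colouring} {f i} → c f ≡ just i →
      uncovered (c [ f ≔ nothing ]) ≡ suc (uncovered c)
    uncovered-uncover {c} {f} cf =
      trans (sym (uncovered-cover {c [ f ≔ nothing ]} {f} (≔-eq {f = c} {f})))
            (cong suc (count-cong λ g → cong isNothing (restore g)))
      where
      restore : ∀ g → ((c [ f ≔ nothing ]) [ f ≔ just _ ]) g ≡ c g
      restore g with g ≟ f
      ... | yes refl = sym cf
      ... | no  _    = refl

    -- The exchange argument.

    module Exchange (c₀ : Colouring) (e₀ : E) (forests₀ : Forests c₀) (c₀e₀ : c₀ e₀ ≡ nothing)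
      -- Maximality of `c₀`, in the weak form that the induction on the number of uncovered edges
      -- supplies.
      (stuck : ∀ c → Forests c → suc (uncovered c) ≢ uncovered c₀) where

      -- Colourings obtained from c₀ by exchanges, together with the edge e
      -- uncovered last: f makes room for e in the forest of colour i.
      data Swaps : Colouring → E → Set where
        start : Swaps c₀ e₀
        swap  : ∀ {c e} i f → Swaps c e → c f ≡ just i →
          ¬ Reach G (without G ⟦ class c i ⟧ f) (src e) (tgt e) →
          Swaps ((c [ f ≔ nothing ]) [ e ≔ just i ]) f

      C : ESet G
      C e = ∃ λ c → Swaps c e

      Within : Colouring → Fin m → ESet G
      Within c i e = ⟦ class c i ⟧ e × C e

      swapped≢ : ∀ {c : Colouring} {e f i} → c e ≡ nothing → c f ≡ just i → e ≢ f
      swapped≢ ce cf refl with trans (sym ce) cf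
      ... | ()

      Swaps-nothing : ∀ {c e} → Swaps c e → c e ≡ nothing
      Swaps-nothing start = c₀e₀
      Swaps-nothing (swap {c} {e} i f s cf _) =
        trans (≔-neq {f = c [ f ≔ nothing ]} {e} (λ f≡e → swapped≢ {c} (Swaps-nothing s) cf (sym f≡e)))
              (≔-eq {f = c} {f})

      Swaps-forests : ∀ {c e} → Swaps c e → Forests c
      Swaps-forests start = forests₀
      Swaps-forests (swap {c} {e} i f s cf ¬p) = Forests-cover (Forests-uncover (Swaps-forests s))
        (λ q → ¬p (Reach-mono (uncover⊆without {c} {f} {i}) q))

      -- A swap covers `e` and uncovers `f`, so every colouring reached is as good as `c₀` and
      -- `stuck` applies to it.
      Swaps-uncovered : ∀ {c e} → Swaps c e → uncovered c ≡ uncovered c₀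
      Swaps-uncovered start = refl
      Swaps-uncovered (swap {c} {e} i f s cf _) = trans
        (suc-injective (trans
          (uncovered-cover {c [ f ≔ nothing ]} {e}
            (trans (≔-neq {f = c} {f} (swapped≢ {c} (Swaps-nothing s) cf)) (Swaps-nothing s)))
          (uncovered-uncover {c} {f} cf)))
        (Swaps-uncovered s)

      -- If class `i` did not join the ends of `e`, colouring `e` with `i` would contradict `stuck`.
      -- Every edge on the joining path can be swapped for `e`, hence belongs to `C`.
      spanned : ∀ {c e} → Swaps c e → ∀ i → Reach G (Within c i) (src e) (tgt e)
      spanned {c} {e} s i with Reach? (class c i) (src e) (tgt e)
      ... | no ¬p = ⊥-elim (stuck (c [ e ≔ just i ]) (Forests-cover (Swaps-forests s) ¬p)
                      (trans (uncovered-cover (Swaps-nothing s)) (Swaps-uncovered s)))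
      ... | yes p = Reach-mono
              (λ f → λ { (cf , ¬q) → cf , _ , swap i f s (is-just cf) ¬q })
              (essential-path (Swaps-forests s i) p)

      -- Undo the swaps one at a time. The only edge a class gains in a swap is `e`, and `spanned`
      -- replaces it by a walk in the previous class within `C`.
      pullback : ∀ {c e} → Swaps c e → ∀ i {u v} → Reach G (Within c i) u v → Reach G (Within c₀ i) u v
      pullback start i p = p
      pullback (swap {c} {e} j f s cf ¬q) i p = pullback s i (Reach-bind old p)
        where
        old : ∀ g → Within ((c [ f ≔ nothing ]) [ e ≔ just j ]) i g → Reach G (Within c i) (src g) (tgt g)
        old g (q , g∈C) with g ≟ e
        ... | yes refl = spanned s i
        ... | no  _    = Reach-edge (proj₁ (uncover⊆without {c} {f} {i} g q) , g∈C)

      -- Each edge of `C` is the uncovered edge of some colouring reached; `spanned` joins its ends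
      -- there and `pullback` brings the walk to `c₀`.
      C-spanned : ∀ i {u v} → Reach G C u v → Reach G (Within c₀ i) u v
      C-spanned i = Reach-bind λ { g (_ , s) → pullback s i (spanned s i) }

      not-sparse : ¬ Sparse m G
      not-sparse sparse = ¬¬-dec C overfull
        where
        overfull : ¬ (∀ e → Dec (C e))
        overfull C? = <⇒≱ few many
          where
          d : E → Bool
          d e = does (C? e)
          d⇒C : ∀ e → ⟦ d ⟧ e → C e
          d⇒C e = does-true⇒ (C? e)
          C⇒d : ∀ e → C e → ⟦ d ⟧ e
          C⇒d e = dec-true (C? e)
          -- The component of `e₀` in `C`, called U in the overview.
          x : V → Bool
          x v = does (Reach? d (src e₀) v)
          x⇒ : ∀ {v} → x v ≡ true → Reach G ⟦ d ⟧ (src e₀) v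
          x⇒ {v} = does-true⇒ (Reach? d (src e₀) v)
          ⇒x : ∀ {v} → Reach G ⟦ d ⟧ (src e₀) v → x v ≡ true
          ⇒x {v} = dec-true (Reach? d (src e₀) v)
          t : Fin m → E → Bool
          t i e = inside x e ∧ class c₀ i e
          closed : ∀ i e → Within c₀ i e → x (src e) ≡ true ⊎ x (tgt e) ≡ true →
            x (src e) ≡ true × x (tgt e) ≡ true
          closed i e (_ , e∈C) (inj₁ xs) = xs , ⇒x (Reach-trans (x⇒ xs) (Reach-edge (C⇒d e e∈C)))
          closed i e (_ , e∈C) (inj₂ xt) = ⇒x (Reach-trans (x⇒ xt) (Reach-edge⁻¹ (C⇒d e e∈C))) , xt
          connected : ∀ i u v → x u ≡ true → x v ≡ true → Reach G ⟦ t i ⟧ u v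
          connected i u v xu xv = Reach-restrict {X = λ w → x w ≡ true} (closed i)
            (λ e w xs xt → ∧-intro (∧-intro xs xt) (proj₁ w)) xu
            (C-spanned i (Reach-mono d⇒C (Reach-trans (Reach-sym (x⇒ xu)) (x⇒ xv))))
          many : m * count x ∸ m ≤ sumF (λ i → count (t i))
          many = m≤n+o⇒m∸n≤o (m * count x) m (begin
            m * count x                   ≡⟨ sumF-const m (count x) ⟨
            sumF (λ (_ : Fin m) → count x)
              ≤⟨ sumF-mono (λ i → connected⇒count (inside-EdgesIn x (class c₀ i)) (connected i)) ⟩
            sumF (λ i → 1 + count (t i))  ≡⟨ sumF-+ (λ _ → 1) (λ i → count (t i)) ⟩
            sumF (λ (_ : Fin m) → 1) + sumF (λ i → count (t i))
              ≡⟨ cong (_+ sumF (λ i → count (t i))) (trans (sumF-const m 1) (*-identityʳ m)) ⟩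
            m + sumF (λ i → count (t i))  ∎)
            where open ≤-Reasoning
          e₀-extra : 1 ≤ count (λ e → inside x e ∧ isNothing (c₀ e))
          e₀-extra = ≤-trans (s≤s z≤n) (≤-reflexive (sym (count-remove e₀ _
            (∧-intro (∧-intro (⇒x here) (⇒x (Reach-edge (C⇒d e₀ (c₀ , start))))) (cong isNothing c₀e₀)))))
          few : sumF (λ i → count (t i)) < m * count x ∸ m
          few = begin
            suc (sumF (λ i → count (t i)))   ≡⟨ +-comm 1 _ ⟩
            sumF (λ i → count (t i)) + 1     ≤⟨ +-monoʳ-≤ _ e₀-extra ⟩
            -- The edges inside `x` are those in the `m` classes and the uncovered ones, among them
            -- `e₀`; this makes the bound strict.
            _                                ≡⟨ count-fibres (inside x) c₀ ⟩
            count (inside x)                 ≤⟨ sparse-mask {m} {x} sparse (⇒x here) ⟩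
            m * count x ∸ m                  ∎
            where open ≤-Reasoning

    -- Forest decompositions and tight vertex sets.

    ForestDecomposition : Set
    ForestDecomposition = Σ Colouring λ c → Forests c × uncovered c ≡ 0

    sparse⇒forests : Sparse m G → ¬ ¬ ForestDecomposition
    -- With no edge covered, all classes are empty and so acyclic.
    sparse⇒forests sparse κ = go _ (λ _ → nothing) refl (λ _ _ ())
      where
      go : ∀ N c → uncovered c ≡ N → Forests c → ⊥
      go zero    c eq forests = κ (c , forests , eq)
      go (suc N) c eq forests with count-witness {t = isNothing ∘ c} eq
      ... | e₀ , p = Exchange.not-sparse c e₀ forests (isNothing⇒ p)
              -- The induction hypothesis refutes every colouring with one uncovered edge fewer, so
              -- the present one may be taken as maximal.
              (λ c′ forests′ eq′ → go N c′ (suc-injective (trans eq′ eq)) forests′) sparse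
        where
        isNothing⇒ : ∀ {y : Maybe (Fin m)} → isNothing y ≡ true → y ≡ nothing
        isNothing⇒ {nothing} _ = refl

    -- The mask `x` makes `X` countable, and `v` makes it nonempty, as the bound on each forest
    -- requires. Tightness is stated additively to avoid truncated subtraction.
    tight⇒trees : ForestDecomposition → ∀ {x} {X : VSet G} {v} →
      (∀ {w} → X w → x w ≡ true) → (∀ {w} → x w ≡ true → X w) → x v ≡ true →
      count (inside x) + m ≡ m * count x → TreeConnected m G X
    tight⇒trees (c , forests , none) {x} {X} {v} X⇒x x⇒X xv tight =
      (λ i → ⟦ t i ⟧) , tree , λ i j e i≢j p q → i≢j (is-injective (c e) (∧-snd {inside x e} p) (∧-snd {inside x e} q))
      where
      t : Fin m → E → Bool
      t i e = inside x e ∧ class c i e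
      t⊆x : ∀ i → EdgesIn x (t i)
      t⊆x i = inside-EdgesIn x (class c i)
      acyclic : ∀ i → Acyclic ⟦ t i ⟧
      acyclic i = Acyclic-⊆ (λ e → ∧-snd {inside x e}) (forests i)
      covered : ∀ e → isNothing (c e) ≡ false
      covered e with isNothing (c e) in eq
      ... | true  = ⊥-elim (count≡0⇒ {t = isNothing ∘ c} none eq)
      ... | false = refl
      uncovered-none : ∀ e → inside x e ∧ isNothing (c e) ≡ false
      uncovered-none e = trans (cong (inside x e ∧_) (covered e)) (Bool.∧-zeroʳ _)
      trees : ℕ
      trees = sumF λ i → count (t i)
      total : sumF (λ i → suc (count (t i))) ≡ m * count x
      total = begin
        sumF (λ i → 1 + count (t i))     ≡⟨ sumF-+ (λ _ → 1) (λ i → count (t i)) ⟩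
        sumF (λ (_ : Fin m) → 1) + trees ≡⟨ cong₂ _+_ (trans (sumF-const m 1) (*-identityʳ m)) (sym (+-identityʳ trees)) ⟩
        -- The zero stands for the uncovered edges inside `x`, of which there are none.
        m + (trees + 0)                  ≡⟨ cong (λ z → m + (trees + z)) (count-false uncovered-none) ⟨
        m + (trees + count (λ e → inside x e ∧ isNothing (c e)))
                                         ≡⟨ cong (m +_) (count-fibres (inside x) c) ⟩
        m + count (inside x)             ≡⟨ +-comm m _ ⟩
        count (inside x) + m             ≡⟨ tight ⟩
        m * count x                      ∎
        where open ≡-Reasoning
      full : ∀ i → suc (count (t i)) ≡ count x
      full = sumF-tight _ (λ i → forest⇒count (t⊆x i) xv (acyclic i)) total
      tree : ∀ i → SpanningTree G X ⟦ t i ⟧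
      tree i = (λ e p → x⇒X (proj₁ (t⊆x i e p)) , x⇒X (proj₂ (t⊆x i e p)))
             , (λ u w xu xw → forest⇒connected (t⊆x i) (acyclic i) (full i) u w (X⇒x xu) (X⇒x xw))
             , acyclic i

  -- Counting over a partition.

  module _ {p : ℕ} (P : Partition G p) where

    partMask : Fin p → V → Bool
    partMask i v = does (i ≟ part P v)

    partMask-nonempty : ∀ i → ∃ λ v → partMask i v ≡ true
    partMask-nonempty i with onto P i
    ... | v , h = v , dec-true (i ≟ part P v) (sym (h refl))

    sum-parts : sumF (λ i → count (partMask i)) ≡ n G
    sum-parts = begin
      sumF (λ i → count (partMask i))      ≡⟨ +-identityʳ _ ⟨
      sumF (λ i → count (partMask i)) + 0  ≡⟨ cong (sumF (λ i → count (partMask i)) +_) (count-false {t = λ (_ : V) → false} (λ _ → refl)) ⟨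
      _                                    ≡⟨ count-fibres (λ _ → true) (λ v → just (part P v)) ⟩
      count {n G} (λ _ → true)             ≡⟨ count-true (n G) ⟩
      n G                                  ∎
      where
      open ≡-Reasoning

    -- Sending crossing edges to `nothing` makes `eCross` the exceptional fibre in `count-fibres`.
    edgePart : E → Maybe (Fin p)
    edgePart e = if does (part P (src e) ≟ part P (tgt e)) then just (part P (src e)) else nothing

    sum-inside : sumF (λ i → count (inside (partMask i))) + eCross G P ≡ k G
    sum-inside = begin
      sumF (λ i → count (inside (partMask i))) + eCross G P
        ≡⟨ cong₂ _+_ (sumF-cong λ i → count-cong (same i)) (count-cong cross) ⟩
      _  ≡⟨ count-fibres (λ _ → true) edgePart ⟩
      count {k G} (λ _ → true)  ≡⟨ count-true (k G) ⟩
      k G  ∎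
      where
      open ≡-Reasoning
      same : ∀ i e → inside (partMask i) e ≡ is i (edgePart e)
      same i e with part P (src e) ≟ part P (tgt e)
      ... | yes eq rewrite sym eq = Bool.∧-idem _
      ... | no neq with i ≟ part P (src e)
      ...   | no  _    = refl
      ...   | yes refl = dec-false (part P (src e) ≟ part P (tgt e)) neq
      cross : ∀ e → not (does (part P (src e) ≟ part P (tgt e))) ≡ isNothing (edgePart e)
      cross e with part P (src e) ≟ part P (tgt e)
      ... | yes _ = refl
      ... | no  _ = refl

    -- This is the contribution of one part, in additive form ready for summation; the bit records
    -- the edge lost when the part is not tight.
    part-bound : ∀ {m} → Sparse m G → ∀ i (b : Bool) → (b ≡ true → ¬ TreeConnected m G (Part P i)) →
      count (inside (partMask i)) + bit b + m ≤ m * count (partMask i)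
    part-bound {m} sparse i b notTC with partMask-nonempty i
    ... | v , xv = go b notTC
      where
      x = partMask i
      -- Since the part is nonempty, the subtraction in the sparsity bound does not truncate.
      m≤ : m ≤ m * count x
      m≤ = ≤-trans (≤-reflexive (sym (*-identityʳ m)))
        (*-monoʳ-≤ m (≤-trans (s≤s z≤n) (≤-reflexive (sym (count-remove v x xv)))))
      bound : count (inside x) + m ≤ m * count x
      bound = ≤-trans (+-monoˡ-≤ m (sparse-mask {m} {x} sparse xv)) (≤-reflexive (m∸n+n≡m m≤))
      go : ∀ b → (b ≡ true → ¬ TreeConnected m G (Part P i)) → count (inside x) + bit b + m ≤ m * count x
      go false _ = subst (λ z → z + m ≤ m * count x) (sym (+-identityʳ _)) bound
      -- Excluding equality is proving a negation, so a forest decomposition known only up to double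
      -- negation suffices.
      go true notTC = subst (λ z → z + m ≤ m * count x) (+-comm 1 _) (≤∧≢⇒< bound λ tight →
        sparse⇒forests sparse λ forests → notTC refl (tight⇒trees forests {x} {Part P i} {v}
          (λ {w} eq → dec-true (i ≟ part P w) (sym eq))
          (λ {w} q → sym (does-true⇒ (i ≟ part P w) q)) xv tight))

theorem2p4 : (m : ℕ) → .{{_ : NonZero m}} → (G : Graph) → Sparse m G
    → k G ≡ m * (n G ∸ 1)
    → (p : ℕ) (P : Partition G p)
    → (nonTC : Fin p → Bool)
    → (∀ i → (nonTC i ≡ true) ⇔ (¬ TreeConnected m G (Part P i)))
    → m * (p ∸ 1) + count nonTC ≤ eCross G P
-- With no parts, `p ∸ 1` truncates to zero and `nonTC` counts nothing.
theorem2p4 m G sparse edges zero P nonTC nonTC⇔ =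
  subst (λ z → z + 0 ≤ eCross G P) (sym (*-zeroʳ m)) z≤n
theorem2p4 m G sparse edges (suc p) P nonTC nonTC⇔ =
  -- Adding the inner edges and one further `m` turns the left side into the summed left sides of
  -- `part-bound`, and the right side into `k G + m`.
  +-cancelˡ-≤ (I + m) _ _ (begin
    (I + m) + (m * p + count nonTC)  ≡⟨ regroup I m p (count nonTC) ⟩
    I + count nonTC + suc p * m      ≡⟨ cong₂ _+_ (cong (I +_) (sumF-bit nonTC)) (sumF-const (suc p) m) ⟨
    I + sumF (bit ∘ nonTC) + sumF all-m
      ≡⟨ cong (_+ sumF all-m) (sumF-+ inner (bit ∘ nonTC)) ⟨
    sumF (λ i → inner i + bit (nonTC i)) + sumF all-m
      ≡⟨ sumF-+ (λ i → inner i + bit (nonTC i)) all-m ⟨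
    sumF (λ i → inner i + bit (nonTC i) + m)
      ≤⟨ sumF-mono (λ i → part-bound G P sparse i (nonTC i) (Equivalence.to (nonTC⇔ i))) ⟩
    sumF (λ i → m * size i)          ≡⟨ sumF-* m size ⟩
    m * sumF size                    ≡⟨ cong (m *_) (sum-parts G P) ⟩
    -- A vertex of part `zero` shows that `n G` is positive, so `n G ∸ 1` does not truncate.
    m * n G                          ≡⟨ edges+m (n G) (proj₁ (onto P zero)) edges ⟩
    k G + m                          ≡⟨ cong (_+ m) (sum-inside G P) ⟨
    I + eCross G P + m               ≡⟨ swapLast I (eCross G P) m ⟩
    I + m + eCross G P               ∎)
  where
  open ≤-Reasoning
  inner size all-m : Fin (suc p) → ℕ
  all-m _ = m
  inner i = count (inside G (partMask G P i))
  size i = count (partMask G P i)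
  I : ℕ
  I = sumF inner
  regroup : ∀ a m p b → (a + m) + (m * p + b) ≡ a + b + suc p * m
  regroup = solve-∀
  swapLast : ∀ a b c → a + b + c ≡ a + c + b
  swapLast = solve-∀
  edges+m : ∀ N → Fin N → k G ≡ m * (N ∸ 1) → m * N ≡ k G + m
  edges+m (suc N) _ eq = trans (*-suc m N) (trans (+-comm m _) (cong (_+ m) (sym eq)))
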